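{- Let $a,b,J$ be positive integers with $J\ge 3$. If $H(a,J) \geq aJ+1$, then $$H(a+b,J) \leq H(a,J) + H(b,J) - \left\lceil\frac{H(a,J) -aJ}{aJ-1}\right\rceil$$ and $$H(2a,J) \leq 2H(a,J) - 2\left\lceil\frac{H(a,J) -aJ}{aJ-1}\right\rceil.$$
   Context: A Golomb ruler is a set $\{a_1,\dots,a_k\}$ of $k$ distinct non-negative integers such that all the differences $a_i-a_j$, $i\neq j$, are distinct. An $(I,J,n)$-DGR is a set of $I$ pairwise disjoint Golomb rulers, each being a $J$-element subset of $\{1,2,\dots,n\}$. For positive integers $I,J$, $H(I,J)$ is the least positive integer $n$ such that there is an $(I,J,n)$-DGR. -}

module Defs where

open import Data.Fin.Base as Fin using (Fin; toℕ; fromℕ<; combine; remQuot; finToFun; funToFin)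
open import Data.Fin.Properties as Fin
  using (all?; any?; toℕ<n; toℕ-fromℕ<; toℕ-injective; combine-injective; remQuot-combine; finToFun-funToFin)
open import Data.Integer.Base as ℤ using (+_)
open import Data.Integer.Properties as ℤ using (+-injective)
open import Data.Integer.Tactic.RingSolver using (solve-∀)
open import Data.Nat.Base
open import Data.Nat.DivMod using (_%_; [m+kn]%n≡m%n)
open import Data.Nat.Induction using (<-rec)
open import Data.Nat.Properties
open import Data.Product.Base using (∃; ∃-syntax; _×_; _,_; proj₁; proj₂)
open import Data.Sum.Base using (_⊎_; inj₁; inj₂)
open import Function.Base using (_∘_; _$_)
open import Function.Definitions using (Injective)
open import Relation.Binary.Definitions using (tri<; tri≈; tri>)
open import Relation.Binary.PropositionalEquality
open import Relation.Nullary.Decidable using (Dec; yes; no; map′; ¬?; _×-dec_; _→-dec_)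
open import Relation.Nullary.Negation using (contradiction)
open import Relation.Unary using (Decidable)

-- A ruler {a₁,…,a_k} is given by an enumeration of its k marks.

record IsGolombRuler {k : ℕ} (a : Fin k → ℕ) : Set where
  field
    distinct    : Injective _≡_ _≡_ a
    differences : ∀ {i j i′ j′} → i ≢ j → i′ ≢ j′ →
                  + a i ℤ.- + a j ≡ + a i′ ℤ.- + a j′ → i ≡ i′ × j ≡ j′

-- For J ≥ 1 disjoint rulers are different sets, so a family indexed by
-- Fin I is the same thing as a set of I rulers.

record IsDGR (I J n : ℕ) (R : Fin I → Fin J → ℕ) : Set where
  field
    golomb   : ∀ r → IsGolombRuler (R r)
    bounded  : ∀ r i → 1 ≤ R r i × R r i ≤ n
    disjoint : ∀ {r s} → r ≢ s → ∀ i j → R r i ≢ R s j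

DGR : (I J n : ℕ) → Set
DGR I J n = ∃[ R ] IsDGR I J n R

IsLeast : (ℕ → Set) → ℕ → Set
IsLeast P n = P n × (∀ m → P m → n ≤ m)

private

  isGolombRuler? : ∀ {k} (a : Fin k → ℕ) → Dec (IsGolombRuler a)
  isGolombRuler? a =
    map′ (λ (d , e) → record { distinct = λ {i} {j} → d i j
                             ; differences = λ {i} {j} {i′} {j′} → e i j i′ j′ })
         (λ g → let open IsGolombRuler g in
                (λ i j → distinct) , (λ i j i′ j′ → differences))
         ((all? λ i → all? λ j → (a i ≟ a j) →-dec (i Fin.≟ j))
          ×-dec
          (all? λ i → all? λ j → all? λ i′ → all? λ j′ →
            ¬? (i Fin.≟ j) →-dec ¬? (i′ Fin.≟ j′) →-dec
            (+ a i ℤ.- + a j ℤ.≟ + a i′ ℤ.- + a j′) →-dec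
            ((i Fin.≟ i′) ×-dec (j Fin.≟ j′))))

  isDGR? : ∀ {I J n} (R : Fin I → Fin J → ℕ) → Dec (IsDGR I J n R)
  isDGR? {n = n} R =
    map′ (λ (g , b , d) → record { golomb = g ; bounded = b ; disjoint = λ {r} {s} → d r s })
         (λ D → let open IsDGR D in golomb , bounded , (λ r s → disjoint))
         ((all? λ r → isGolombRuler? (R r))
          ×-dec (all? λ r → all? λ i → (1 ≤? R r i) ×-dec (R r i ≤? n))
          ×-dec (all? λ r → all? λ s → ¬? (r Fin.≟ s) →-dec
                  (all? λ i → all? λ j → ¬? (R r i ≟ R s j))))

  isGolombRuler-resp : ∀ {k} {a b : Fin k → ℕ} → a ≗ b → IsGolombRuler a → IsGolombRuler b
  isGolombRuler-resp {a = a} {b} a≗b g = record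
    { distinct    = λ {i} {j} e → distinct (trans (a≗b i) (trans e (sym (a≗b j))))
    ; differences = λ {i} {j} {i′} {j′} i≢j i′≢j′ e →
        differences i≢j i′≢j′ (trans (eq i j) (trans e (sym (eq i′ j′))))
    }
    where
    open IsGolombRuler g
    eq : ∀ i j → + a i ℤ.- + a j ≡ + b i ℤ.- + b j
    eq i j = cong₂ (λ x y → + x ℤ.- + y) (a≗b i) (a≗b j)

  isDGR-resp : ∀ {I J n} {R S : Fin I → Fin J → ℕ} → (∀ r → R r ≗ S r) →
               IsDGR I J n R → IsDGR I J n S
  isDGR-resp {n = n} R≗S D = record
    { golomb   = λ r → isGolombRuler-resp (R≗S r) (golomb r)
    ; bounded  = λ r i → subst (λ x → 1 ≤ x × x ≤ n) (R≗S r i) (bounded r i)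
    ; disjoint = λ {r} {s} r≢s i j e →
        disjoint r≢s i j (trans (R≗S r i) (trans e (sym (R≗S s j))))
    }
    where open IsDGR D

  dgr? : ∀ I J n → Dec (DGR I J n)
  dgr? I J n = map′ (λ (c , D) → decode c , D) encode (any? (isDGR? ∘ decode))
    where
    decode : Fin (n ^ (I * J)) → Fin I → Fin J → ℕ
    decode c r i = suc (toℕ (finToFun c (combine r i)))

    encode : DGR I J n → ∃[ c ] IsDGR I J n (decode c)
    encode (R , D) = funToFin f , isDGR-resp eq D
      where
      open IsDGR D
      pred-bound : ∀ {x} → 1 ≤ x × x ≤ n → pred x < n
      pred-bound {suc x} (_ , x<n) = x<n

      suc-pred-bound : ∀ {x} → 1 ≤ x × x ≤ n → suc (pred x) ≡ x
      suc-pred-bound {suc x} _ = refl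

      g : Fin I × Fin J → Fin n
      g (r , i) = fromℕ< (pred-bound (bounded r i))

      f : Fin (I * J) → Fin n
      f = g ∘ remQuot J

      eq : ∀ r i → R r i ≡ decode (funToFin f) r i
      eq r i = sym $ begin
        suc (toℕ (finToFun (funToFin f) (combine r i)))
          ≡⟨ cong (suc ∘ toℕ) (finToFun-funToFin f (combine r i)) ⟩
        suc (toℕ (f (combine r i)))
          ≡⟨ cong (suc ∘ toℕ ∘ g) (remQuot-combine r i) ⟩
        suc (toℕ (g (r , i)))
          ≡⟨ cong suc (toℕ-fromℕ< _) ⟩
        suc (pred (R r i))
          ≡⟨ suc-pred-bound (bounded r i) ⟩
        R r i ∎
        where open ≡-Reasoning

  -- For some n there is an (I,J,n)-DGR: distribute I * J distinct powers
  -- of 3, which together form one Golomb ruler, among the I rulers.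

  δ : ℕ → ℕ
  δ zero    = 1
  δ (suc _) = 0

  3^+3^%3 : ∀ x y → (3 ^ x + 3 ^ y) % 3 ≡ δ x + δ y
  3^+3^%3 zero    zero    = refl
  3^+3^%3 zero    (suc y) = trans (cong (λ z → (1 + z) % 3) (*-comm 3 (3 ^ y))) ([m+kn]%n≡m%n 1 (3 ^ y) 3)
  3^+3^%3 (suc x) zero    = trans (cong (_% 3) (+-comm (3 ^ suc x) 1)) (3^+3^%3 zero (suc x))
  3^+3^%3 (suc x) (suc y) =
    trans (cong (_% 3) (trans (sym (*-distribˡ-+ 3 (3 ^ x) (3 ^ y))) (*-comm 3 (3 ^ x + 3 ^ y))))
          ([m+kn]%n≡m%n 0 (3 ^ x + 3 ^ y) 3)

  3^-injective : ∀ x y → 3 ^ x ≡ 3 ^ y → x ≡ y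
  3^-injective x y e with <-cmp x y
  ... | tri< x<y _ _ = contradiction e (<⇒≢ (^-monoʳ-< 3 (s≤s (s≤s z≤n)) x<y))
  ... | tri≈ _ x≡y _ = x≡y
  ... | tri> _ _ y<x = contradiction (sym e) (<⇒≢ (^-monoʳ-< 3 (s≤s (s≤s z≤n)) y<x))

  3^+3^-injective : ∀ x w z y → 3 ^ x + 3 ^ w ≡ 3 ^ z + 3 ^ y →
                    (x ≡ z × w ≡ y) ⊎ (x ≡ y × w ≡ z)
  3^+3^-injective x w z y e =
    go x w z y e (trans (sym (3^+3^%3 x w)) (trans (cong (_% 3) e) (3^+3^%3 z y)))
    where
    go : ∀ x w z y → 3 ^ x + 3 ^ w ≡ 3 ^ z + 3 ^ y → δ x + δ w ≡ δ z + δ y →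
         (x ≡ z × w ≡ y) ⊎ (x ≡ y × w ≡ z)
    go zero    zero    zero    zero    e _ = inj₁ (refl , refl)
    go zero    zero    zero    (suc y) e ()
    go zero    zero    (suc z) (suc y) e ()
    go zero    (suc w) zero    (suc y) e _ = inj₁ (refl , 3^-injective (suc w) (suc y) (suc-injective e))
    go zero    (suc w) (suc z) zero    e _ =
      inj₂ (refl , 3^-injective (suc w) (suc z) (suc-injective (trans e (+-comm (3 ^ suc z) 1))))
    go (suc x) zero    zero    (suc y) e _ =
      inj₂ (3^-injective (suc x) (suc y) (suc-injective (trans (+-comm 1 (3 ^ suc x)) e)) , refl)
    go (suc x) zero    (suc z) zero    e _ =
      inj₁ (3^-injective (suc x) (suc z) (+-cancelʳ-≡ 1 (3 ^ suc x) (3 ^ suc z) e) , refl)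
    go (suc x) (suc w) (suc z) (suc y) e _
      with 3^+3^-injective x w z y
             (*-cancelˡ-≡ _ _ 3
               (trans (*-distribˡ-+ 3 (3 ^ x) (3 ^ w))
                 (trans e (sym (*-distribˡ-+ 3 (3 ^ z) (3 ^ y))))))
    ... | inj₁ (p , q) = inj₁ (cong suc p , cong suc q)
    ... | inj₂ (p , q) = inj₂ (cong suc p , cong suc q)

  cross : ∀ p q s t → + p ℤ.- + q ≡ + s ℤ.- + t → p + t ≡ s + q
  cross p q s t e = +-injective $ begin
    + p ℤ.+ + t                     ≡⟨ left (+ p) (+ q) (+ t) ⟩
    (+ p ℤ.- + q) ℤ.+ (+ q ℤ.+ + t) ≡⟨ cong (ℤ._+ (+ q ℤ.+ + t)) e ⟩
    (+ s ℤ.- + t) ℤ.+ (+ q ℤ.+ + t) ≡⟨ right (+ s) (+ t) (+ q) ⟩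
    + s ℤ.+ + q                     ∎
    where
    open ≡-Reasoning
    left : ∀ p q t → p ℤ.+ t ≡ (p ℤ.- q) ℤ.+ (q ℤ.+ t)
    left = solve-∀
    right : ∀ s t q → (s ℤ.- t) ℤ.+ (q ℤ.+ t) ≡ s ℤ.+ q
    right = solve-∀

  dgr-exists : ∀ I J → ∃[ n ] (1 ≤ n × DGR I J n)
  dgr-exists I J = 3 ^ (I * J) , m^n>0 3 (I * J) , R , record
    { golomb   = λ r → record { distinct = λ e → proj₂ (R-injective e) ; differences = diff r }
    ; bounded  = λ r i → m^n>0 3 (code r i) , ^-monoʳ-≤ 3 (<⇒≤ (toℕ<n (combine r i)))
    ; disjoint = λ r≢s i j e → r≢s (proj₁ (R-injective e))
    }
    where
    code : Fin I → Fin J → ℕ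
    code r i = toℕ (combine r i)

    R : Fin I → Fin J → ℕ
    R r i = 3 ^ code r i

    code-injective : ∀ {r i s j} → code r i ≡ code s j → r ≡ s × i ≡ j
    code-injective {r} {i} {s} {j} e = combine-injective r i s j (toℕ-injective e)

    R-injective : ∀ {r i s j} → R r i ≡ R s j → r ≡ s × i ≡ j
    R-injective e = code-injective (3^-injective _ _ e)

    diff : ∀ r {i j i′ j′} → i ≢ j → i′ ≢ j′ →
           + R r i ℤ.- + R r j ≡ + R r i′ ℤ.- + R r j′ → i ≡ i′ × j ≡ j′
    diff r {i} {j} {i′} {j′} i≢j _ e
      with 3^+3^-injective (code r i) (code r j′) (code r i′) (code r j)
             (cross (R r i) (R r j) (R r i′) (R r j′) e)
    ... | inj₁ (p , q) = proj₂ (code-injective p) , sym (proj₂ (code-injective q))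
    ... | inj₂ (p , _) = contradiction (proj₂ (code-injective p)) i≢j

  least : {P : ℕ → Set} → Decidable P → ∀ n → P n → ∃ (IsLeast P)
  least {P} P? = <-rec _ step
    where
    step : ∀ n → (∀ {m} → m < n → P m → ∃ (IsLeast P)) → P n → ∃ (IsLeast P)
    step n rec Pn with anyUpTo? P? n
    ... | yes (m , m<n , Pm) = rec m<n Pm
    ... | no  none           = n , Pn , λ m Pm → ≮⇒≥ (λ m<n → none (m , m<n , Pm))

-- Abstract, so that the search is never unfolded; H-isLeast determines H.

abstract
  leastDGR : ∀ I J → ∃ (IsLeast (λ n → 1 ≤ n × DGR I J n))
  leastDGR I J = least (λ n → (1 ≤? n) ×-dec dgr? I J n) _ (proj₂ (dgr-exists I J))

H : ℕ → ℕ → ℕ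
H I J = proj₁ (leastDGR I J)

H-isLeast : ∀ I J → IsLeast (λ n → 1 ≤ n × DGR I J n) (H I J)
H-isLeast I J = proj₂ (leastDGR I J)

a*J∸1≢0 : ∀ a J .{{_ : NonZero a}} → 3 ≤ J → NonZero (a * J ∸ 1)
a*J∸1≢0 (suc a) (suc (suc J)) _         = _
a*J∸1≢0 (suc a) (suc zero)    (s≤s ())

{-# OPTIONS --safe #-}

-- An optimal (a,J,n)-DGR, n = H(a,J), uses both 1 and n, so by pigeonhole its
-- aJ marks leave c = ⌈(n - aJ)/(aJ - 1)⌉ consecutive positions unused.  Write
-- n = p + c + q, with all marks in a lower block L of length p or an upper
-- block U of length q.
--
-- Translating two blocks of a Golomb ruler independently keeps it Golomb as
-- long as the differences across the blocks exceed all those inside a block.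
-- Hence two copies of the DGR fit into 2(p + q) positions, as U₁ L₂ L₁ U₂ if
-- p ≥ q and as L₁ U₂ U₁ L₂ otherwise.  Let B be an optimal (b,J,m)-DGR.  If
-- m ≥ p, q, then L B U works.  Otherwise cut B instead: c of its positions go
-- into the gap and the others beyond the longer one of L and U, which separates
-- the two parts of B by more than m.

module Submission where

open import Defs
open import Data.Bool.Base using (Bool; true; false; not)
import Data.Bool.Properties as Bool
open import Data.Fin.Base as Fin using (Fin; zero; suc; toℕ; combine; splitAt; join)
import Data.Fin.Properties as Fin
open import Data.Integer.Base as ℤ using (+_; _-_; _+_; _*_; _≤_)
import Data.Integer.Properties as ℤ
import Data.Integer.Tactic.RingSolver as ℤ-Solver
open import Data.Nat.Base as ℕ using (ℕ; zero; suc; NonZero; z≤n; s≤s)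
open import Data.Nat.DivMod using (m≡m%n+[m/n]*n; m/n*n≤m)
import Data.Nat.Properties as ℕ
import Data.Nat.Tactic.RingSolver as ℕ-Solver
open import Data.Product.Base using (∃; ∃₂; ∃-syntax; _×_; _,_; proj₁; proj₂)
open import Data.Rational.Unnormalised.Base using (_/_; ceiling)
open import Data.Sum.Base using (_⊎_; inj₁; inj₂; [_,_]′)
open import Function.Base using (_∘_)
open import Relation.Binary.PropositionalEquality
open import Relation.Nullary.Decidable using (Dec; yes; no; ¬?; _×-dec_; decidable-stable)
open import Relation.Nullary.Negation using (¬_; contradiction)

-- Translations and splices of Golomb rulers

private

  sum-eq : ∀ p q s t → + p - + q ≡ + s - + t → p ℕ.+ t ≡ s ℕ.+ q
  sum-eq p q s t e = ℤ.+-injective (begin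
    + p + + t                 ≡⟨ left (+ p) (+ q) (+ t) ⟩
    (+ p - + q) + (+ q + + t) ≡⟨ cong (_+ (+ q + + t)) e ⟩
    (+ s - + t) + (+ q + + t) ≡⟨ right (+ s) (+ t) (+ q) ⟩
    + s + + q                 ∎)
    where
    open ≡-Reasoning
    left : ∀ p q t → p + t ≡ (p - q) + (q + t)
    left = ℤ-Solver.solve-∀
    right : ∀ s t q → (s - t) + (q + t) ≡ s + q
    right = ℤ-Solver.solve-∀

  swap-differences : ∀ p q s t → p - q ≡ s - t → p - s ≡ q - t
  swap-differences p q s t e = begin
    p - s             ≡⟨ left p q s ⟩
    (p - q) + (q - s) ≡⟨ cong (_+ (q - s)) e ⟩
    (s - t) + (q - s) ≡⟨ right s t q ⟩
    q - t             ∎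
    where
    open ≡-Reasoning
    left : ∀ p q s → p - s ≡ (p - q) + (q - s)
    left = ℤ-Solver.solve-∀
    right : ∀ s t q → (s - t) + (q - s) ≡ q - t
    right = ℤ-Solver.solve-∀

  translation-difference : ∀ t u {x y x′ y′} → t ℕ.+ x ≡ u ℕ.+ y → t ℕ.+ x′ ≡ u ℕ.+ y′ →
                           + y - + y′ ≡ + x - + x′
  translation-difference t u {x} {y} {x′} {y′} e e′ = begin
    + y - + y′                     ≡⟨ cancel (+ u) (+ y) (+ y′) ⟨
    + (u ℕ.+ y) - + (u ℕ.+ y′)     ≡⟨ cong₂ (λ v w → + v - + w) e e′ ⟨
    + (t ℕ.+ x) - + (t ℕ.+ x′)     ≡⟨ cancel (+ t) (+ x) (+ x′) ⟩
    + x - + x′                     ∎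
    where
    open ≡-Reasoning
    cancel : ∀ t x y → (t + x) - (t + y) ≡ x - y
    cancel = ℤ-Solver.solve-∀

golomb-reflect : ∀ {k} {a b : Fin k → ℕ} → IsGolombRuler a →
                 (∀ i j i′ j′ → + b i - + b j ≡ + b i′ - + b j′ →
                                + a i - + a j ≡ + a i′ - + a j′) →
                 IsGolombRuler b
golomb-reflect {a = a} {b} g reflect = record
  -- If `b i ≡ b j` with `i ≢ j`, the pairs (i,j) and (j,i) have the same difference, which forces
  -- `i ≡ j`; so distinctness follows from `diff`.
  { distinct    = λ {i} {j} e → decidable-stable (i Fin.≟ j) λ i≢j →
      i≢j (proj₁ (diff i≢j (i≢j ∘ sym) (cong₂ (λ x y → + x - + y) e (sym e))))
  ; differences = diff
  }
  where
  diff : ∀ {i j i′ j′} → i ≢ j → i′ ≢ j′ → + b i - + b j ≡ + b i′ - + b j′ → i ≡ i′ × j ≡ j′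
  diff i≢j i′≢j′ e = IsGolombRuler.differences g i≢j i′≢j′ (reflect _ _ _ _ e)

-- By `narrow`, differences of `b` inside a block are below `D` in absolute value; by `wide`, those
-- across the blocks are at least `D`. Hence two equal differences are both inside blocks, where
-- `same` carries them back to `a`, or both across.
module _ {k : ℕ} {a b : Fin k → ℕ} (upper : Fin k → Bool) (D : ℕ)
  (same   : ∀ i j → upper i ≡ upper j → + b i - + b j ≡ + a i - + a j)
  (narrow : ∀ i j → upper i ≡ upper j → b i ℕ.< b j ℕ.+ D)
  (wide   : ∀ i j → upper i ≡ true → upper j ≡ false → b j ℕ.+ D ℕ.≤ b i)
  where

  private

    orient : ∀ i j → upper i ≢ upper j →
             (upper i ≡ true × upper j ≡ false) ⊎ (upper j ≡ true × upper i ≡ false)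
    orient i j ne with upper i | upper j
    ... | true  | true  = contradiction refl ne
    ... | true  | false = inj₁ (refl , refl)
    ... | false | true  = inj₂ (refl , refl)
    ... | false | false = contradiction refl ne

    same≢cross : ∀ i j i′ j′ → upper i ≡ upper j → upper i′ ≢ upper j′ →
                 + b i - + b j ≢ + b i′ - + b j′
    same≢cross i j i′ j′ s ne e with orient i′ j′ ne
    ... | inj₁ (t , f) = ℕ.<-irrefl (sum-eq (b i) (b j) (b i′) (b j′) e) (begin-strict
      b i ℕ.+ b j′               <⟨ ℕ.+-monoˡ-< (b j′) (narrow i j s) ⟩
      b j ℕ.+ D ℕ.+ b j′         ≡⟨ lemma (b j) D (b j′) ⟩
      b j′ ℕ.+ D ℕ.+ b j         ≤⟨ ℕ.+-monoˡ-≤ (b j) (wide i′ j′ t f) ⟩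
      b i′ ℕ.+ b j               ∎)
      where
      open ℕ.≤-Reasoning
      lemma : ∀ x d y → x ℕ.+ d ℕ.+ y ≡ y ℕ.+ d ℕ.+ x
      lemma = ℕ-Solver.solve-∀
    ... | inj₂ (t , f) = ℕ.<-irrefl (sym (sum-eq (b i) (b j) (b i′) (b j′) e)) (begin-strict
      b i′ ℕ.+ b j               <⟨ ℕ.+-monoʳ-< (b i′) (narrow j i (sym s)) ⟩
      b i′ ℕ.+ (b i ℕ.+ D)       ≡⟨ lemma (b i′) (b i) D ⟩
      b i ℕ.+ (b i′ ℕ.+ D)       ≤⟨ ℕ.+-monoʳ-≤ (b i) (wide j′ i′ t f) ⟩
      b i ℕ.+ b j′               ∎)
      where
      open ℕ.≤-Reasoning
      lemma : ∀ x y d → x ℕ.+ (y ℕ.+ d) ≡ y ℕ.+ (x ℕ.+ d)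
      lemma = ℕ-Solver.solve-∀

    -- The distance between the blocks may have changed, so `same` says nothing about `b i - b j`.
    -- Exchanging the middle terms gives an equation between `b i - b i′` and `b j - b j′`, both
    -- inside a block.
    parallel : ∀ i j i′ j′ → upper i ≡ upper i′ → upper j ≡ upper j′ →
               + b i - + b j ≡ + b i′ - + b j′ → + a i - + a j ≡ + a i′ - + a j′
    parallel i j i′ j′ s s′ e = swap-differences (+ a i) (+ a i′) (+ a j) (+ a j′) (begin
      + a i - + a i′ ≡⟨ same i i′ s ⟨
      + b i - + b i′ ≡⟨ swap-differences (+ b i) (+ b j) (+ b i′) (+ b j′) e ⟩
      + b j - + b j′ ≡⟨ same j j′ s′ ⟩
      + a j - + a j′ ∎)
      where open ≡-Reasoning

    antiparallel : ∀ i j i′ j′ → upper i ≡ true → upper j ≡ false →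
                   upper j′ ≡ true → upper i′ ≡ false → + b i - + b j ≢ + b i′ - + b j′
    -- The equation says that `b i + b j′` equals `b i′ + b j`, but `b i′ < b j + D ≤ b i` and
    -- `b j < b i′ + D ≤ b j′`.
    antiparallel i j i′ j′ t f t′ f′ e = ℕ.<-irrefl (sym (sum-eq (b i) (b j) (b i′) (b j′) e)) (ℕ.+-mono-<
      (ℕ.<-≤-trans (narrow i′ j (trans f′ (sym f))) (wide i j t f))
      (ℕ.<-≤-trans (narrow j i′ (trans f (sym f′))) (wide j′ i′ t′ f′)))

    reflects : ∀ i j i′ j′ → + b i - + b j ≡ + b i′ - + b j′ → + a i - + a j ≡ + a i′ - + a j′
    reflects i j i′ j′ e with upper i Bool.≟ upper j | upper i′ Bool.≟ upper j′
    ... | yes s | yes s′ = trans (sym (same i j s)) (trans e (same i′ j′ s′))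
    ... | yes s | no n′  = contradiction e (same≢cross i j i′ j′ s n′)
    ... | no n  | yes s′ = contradiction (sym e) (same≢cross i′ j′ i j s′ n)
    ... | no n  | no n′ with orient i j n | orient i′ j′ n′
    ...   | inj₁ (t , f) | inj₁ (t′ , f′) =
      parallel i j i′ j′ (trans t (sym t′)) (trans f (sym f′)) e
    ...   | inj₂ (t , f) | inj₂ (t′ , f′) =
      parallel i j i′ j′ (trans f (sym f′)) (trans t (sym t′)) e
    ...   | inj₁ (t , f) | inj₂ (t′ , f′) = contradiction e (antiparallel i j i′ j′ t f t′ f′)
    ...   | inj₂ (t , f) | inj₁ (t′ , f′) =
      contradiction (sym e) (antiparallel i′ j′ i j t′ f′ t f)

  golomb-piecewise : IsGolombRuler a → IsGolombRuler b
  golomb-piecewise g = golomb-reflect g reflects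

-- The half-open interval (l, l + n] of n positions: adjacent blocks share an endpoint, and
-- {1,...,n} is `In 0 n`.
In : ℕ → ℕ → ℕ → Set
In l n x = l ℕ.< x × x ℕ.≤ l ℕ.+ n

In-disjoint : ∀ {l n l′ n′ x y} → l ℕ.+ n ℕ.≤ l′ → In l n x → In l′ n′ y → x ≢ y
In-disjoint le (_ , x≤) (<y , _) refl = ℕ.<-irrefl refl (ℕ.<-≤-trans <y (ℕ.≤-trans x≤ le))

In-shift : ∀ t {l n x} → In l n x → In (t ℕ.+ l) n (t ℕ.+ x)
In-shift t {l} {n} (lo , hi) =
  ℕ.+-monoʳ-< t lo , ℕ.≤-trans (ℕ.+-monoʳ-≤ t hi) (ℕ.≤-reflexive (sym (ℕ.+-assoc t l n)))

In-bounded : ∀ {l n N x} → l ℕ.+ n ℕ.≤ N → In l n x → 1 ℕ.≤ x × x ℕ.≤ N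
In-bounded le (lo , hi) = ℕ.≤-trans (s≤s z≤n) lo , ℕ.≤-trans hi le

InEither : ℕ → ℕ → ℕ → ℕ → ℕ → Set
InEither l n l′ n′ x = In l n x ⊎ In l′ n′ x

-- A shift by t - u, with one offset on each side so that downward shifts avoid truncated
-- subtraction.
translate : ∀ {I J n N R T} t u → IsDGR I J n R →
            (∀ r i → t ℕ.+ R r i ≡ u ℕ.+ T r i) → (∀ r i → 1 ℕ.≤ T r i × T r i ℕ.≤ N) →
            IsDGR I J N T
translate {R = R} {T} t u D e bnd = record
  { golomb   = λ r → golomb-reflect (golomb r) λ i j i′ j′ d →
      trans (sym (diff r i j)) (trans d (diff r i′ j′))
  ; bounded  = bnd
  ; disjoint = λ {r} {s} r≢s i j eq → disjoint r≢s i j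
      (ℕ.+-cancelˡ-≡ t _ _ (trans (e r i) (trans (cong (u ℕ.+_) eq) (sym (e s j)))))
  }
  where
  open IsDGR D
  diff : ∀ r i j → + T r i - + T r j ≡ + R r i - + R r j
  diff r i j = translation-difference t u (e r i) (e r j)

-- The translation of (0,p] to (α,α+p] and of (k,k+q] to (β,β+q], as a graph.

data Splice (p k q α β : ℕ) : ℕ → ℕ → Set where
  lower : ∀ {x} → In 0 p x → Splice p k q α β x (α ℕ.+ x)
  upper : ∀ {x} → In 0 q x → Splice p k q α β (k ℕ.+ x) (β ℕ.+ x)

splice : ∀ {p k q x} α β → InEither 0 p k q x → ∃ (Splice p k q α β x)
splice α β (inj₁ h) = _ , lower h
splice {k = k} {x = x} α β (inj₂ (lo , hi)) with ℕ.m≤n⇒∃[o]m+o≡n (ℕ.<⇒≤ lo)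
... | y , refl = _ , upper (ℕ.+-cancelˡ-< k 0 y (subst (ℕ._< k ℕ.+ y) (sym (ℕ.+-identityʳ k)) lo)
                           , ℕ.+-cancelˡ-≤ k _ _ hi)

splice-In : ∀ {p k q α β x y} → Splice p k q α β x y → InEither α p β q y
splice-In {p} {α = α} (lower {x} h) =
  inj₁ (subst (λ l → In l p (α ℕ.+ x)) (ℕ.+-identityʳ α) (In-shift α h))
splice-In {q = q} {β = β} (upper {x} h) =
  inj₂ (subst (λ l → In l q (β ℕ.+ x)) (ℕ.+-identityʳ β) (In-shift β h))

private

  -- The Boolean tells whether the lower block lands above the upper one.

  onTop : ∀ {p k q α β x y} → Bool → Splice p k q α β x y → Bool
  onTop b (lower _) = b
  onTop b (upper _) = not b

  Separated : Bool → (p q α β D : ℕ) → Set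
  Separated true  p q α β D = β ℕ.+ q ℕ.+ D ℕ.≤ α
  Separated false p q α β D = α ℕ.+ p ℕ.+ D ℕ.≤ β

  splice-same : ∀ {p k q α β x y x′ y′} b →
                (s : Splice p k q α β x y) (s′ : Splice p k q α β x′ y′) →
                onTop b s ≡ onTop b s′ → + y - + y′ ≡ + x - + x′
  splice-same {α = α} b (lower _) (lower _) _ = translation-difference α 0 refl refl
  splice-same {k = k} {β = β} b (upper {x} _) (upper {x′} _) _ =
    translation-difference β k (exchange β k x) (exchange β k x′)
    where
    exchange : ∀ m n o → m ℕ.+ (n ℕ.+ o) ≡ n ℕ.+ (m ℕ.+ o)
    exchange = ℕ-Solver.solve-∀
  splice-same true  (lower _) (upper _) ()
  splice-same false (lower _) (upper _) ()
  splice-same true  (upper _) (lower _) ()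
  splice-same false (upper _) (lower _) ()

  shift-narrow : ∀ l {n D x x′} → n ℕ.≤ D → In 0 n x → In 0 n x′ → l ℕ.+ x ℕ.< l ℕ.+ x′ ℕ.+ D
  shift-narrow l {n} {D} {x} {x′} n≤D (_ , x≤n) (0<x′ , _) = begin-strict
    l ℕ.+ x           ≤⟨ ℕ.+-monoʳ-≤ l (ℕ.≤-trans x≤n n≤D) ⟩
    l ℕ.+ D           <⟨ ℕ.+-monoʳ-< l (ℕ.+-monoˡ-< D 0<x′) ⟩
    l ℕ.+ (x′ ℕ.+ D)  ≡⟨ ℕ.+-assoc l x′ D ⟨
    l ℕ.+ x′ ℕ.+ D    ∎
    where open ℕ.≤-Reasoning

  shift-wide : ∀ l n l′ {D x x′} → l ℕ.+ n ℕ.+ D ℕ.≤ l′ → x ℕ.≤ n → l ℕ.+ x ℕ.+ D ℕ.≤ l′ ℕ.+ x′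
  shift-wide l n l′ {D} {x} {x′} sep x≤n = begin
    l ℕ.+ x ℕ.+ D ≤⟨ ℕ.+-monoˡ-≤ D (ℕ.+-monoʳ-≤ l x≤n) ⟩
    l ℕ.+ n ℕ.+ D ≤⟨ sep ⟩
    l′            ≤⟨ ℕ.m≤m+n l′ x′ ⟩
    l′ ℕ.+ x′     ∎
    where open ℕ.≤-Reasoning

  module _ {p k q α β D : ℕ} (p≤D : p ℕ.≤ D) (q≤D : q ℕ.≤ D) where

    splice-narrow : ∀ {x y x′ y′} b →
                    (s : Splice p k q α β x y) (s′ : Splice p k q α β x′ y′) →
                    onTop b s ≡ onTop b s′ → y ℕ.< y′ ℕ.+ D
    splice-narrow b     (lower h) (lower h′) _ = shift-narrow α p≤D h h′
    splice-narrow b     (upper h) (upper h′) _ = shift-narrow β q≤D h h′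
    splice-narrow true  (lower _) (upper _)  ()
    splice-narrow false (lower _) (upper _)  ()
    splice-narrow true  (upper _) (lower _)  ()
    splice-narrow false (upper _) (lower _)  ()

    splice-wide : ∀ {x y x′ y′} b → Separated b p q α β D →
                  (s : Splice p k q α β x y) (s′ : Splice p k q α β x′ y′) →
                  onTop b s ≡ true → onTop b s′ ≡ false → y′ ℕ.+ D ℕ.≤ y
    splice-wide true  sep (lower _) (upper h) _ _  = shift-wide β q α sep (proj₂ h)
    splice-wide false sep (upper _) (lower h) _ _  = shift-wide α p β sep (proj₂ h)
    splice-wide true  sep (lower _) (lower _) _ ()
    splice-wide true  sep (upper _) _         () _
    splice-wide false sep (lower _) _         () _
    splice-wide false sep (upper _) (upper _) _ ()

    blocks-disjoint : ∀ {x x′} b → Separated b p q α β D → In 0 p x → In 0 q x′ →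
                      α ℕ.+ x ≢ β ℕ.+ x′
    blocks-disjoint true sep (0<x , _) (_ , x′≤q) e = ℕ.<-irrefl (sym e)
      -- The value `x′ = 0` compares with the excluded left end of the upper interval, which lies
      -- strictly below its marks.
      (ℕ.≤-<-trans (ℕ.≤-trans (ℕ.m≤m+n _ D) (shift-wide β q α {x′ = 0} sep x′≤q))
                   (ℕ.+-monoʳ-< α 0<x))
    blocks-disjoint false sep (_ , x≤p) (0<x′ , _) e = ℕ.<-irrefl e
      (ℕ.≤-<-trans (ℕ.≤-trans (ℕ.m≤m+n _ D) (shift-wide α p β {x′ = 0} sep x≤p))
                   (ℕ.+-monoʳ-< β 0<x′))

    splice-disjoint : ∀ {x y x′ y′} b → Separated b p q α β D →
                      Splice p k q α β x y → Splice p k q α β x′ y′ → x ≢ x′ → y ≢ y′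
    splice-disjoint b sep (lower _) (lower _) ne e = ne (ℕ.+-cancelˡ-≡ α _ _ e)
    splice-disjoint b sep (upper _) (upper _) ne e = ne (cong (k ℕ.+_) (ℕ.+-cancelˡ-≡ β _ _ e))
    splice-disjoint b sep (lower h) (upper h′) _ e = blocks-disjoint b sep h h′ e
    splice-disjoint b sep (upper h) (lower h′) _ e = blocks-disjoint b sep h′ h (sym e)

-- Blocks of length at most `D` placed at least `D` apart satisfy the hypotheses of
-- `golomb-piecewise`, ruler by ruler. The final component records where the marks land, for later
-- disjointness proofs.
spliceDGR : ∀ {I J n N p k q R} b α β D →
            p ℕ.≤ D → q ℕ.≤ D → Separated b p q α β D → α ℕ.+ p ℕ.≤ N → β ℕ.+ q ℕ.≤ N →
            IsDGR I J n R → (∀ r i → InEither 0 p k q (R r i)) →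
            ∃[ T ] (IsDGR I J N T × (∀ r i → InEither α p β q (T r i)))
spliceDGR {R = R} b α β D p≤D q≤D sep α+p≤N β+q≤N isDGR block =
  (λ r i → proj₁ (sp r i)) , record
    { golomb   = λ r → golomb-piecewise (λ i → onTop b (s r i)) D
        (λ i j → splice-same b (s r i) (s r j))
        (λ i j → splice-narrow p≤D q≤D b (s r i) (s r j))
        (λ i j → splice-wide p≤D q≤D b sep (s r i) (s r j))
        (golomb r)
    ; bounded  = λ r i → [ In-bounded α+p≤N , In-bounded β+q≤N ]′ (splice-In (s r i))
    ; disjoint = λ {r} {t} r≢t i j →
        splice-disjoint p≤D q≤D b sep (s r i) (s t j) (disjoint r≢t i j)
    } , λ r i → splice-In (s r i)
  where
  open IsDGR isDGR
  sp : ∀ r i → ∃ (Splice _ _ _ α β (R r i))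
  sp r i = splice α β (block r i)
  s : ∀ r i → Splice _ _ _ α β (R r i) (proj₁ (sp r i))
  s r i = proj₂ (sp r i)

-- Unions and concatenations of DGRs

joinDGR : ∀ {a b J n R S} → IsDGR a J n R → IsDGR b J n S → (∀ r i s j → R r i ≢ S s j) →
          DGR (a ℕ.+ b) J n
joinDGR {a} {b} {J} {n} {R} {S} D E apart = (λ r → T (splitAt a r)) , record
  { golomb   = λ r → golomb′ (splitAt a r)
  ; bounded  = λ r → bounded′ (splitAt a r)
  ; disjoint = λ {r} {s} r≢s → disjoint′ (splitAt a r) (splitAt a s) λ e →
      r≢s (trans (sym (Fin.join-splitAt a b r)) (trans (cong (join a b) e) (Fin.join-splitAt a b s)))
  }
  where
  module D = IsDGR D
  module E = IsDGR E
  T : Fin a ⊎ Fin b → Fin J → ℕ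
  T = [ R , S ]′
  golomb′ : ∀ r → IsGolombRuler (T r)
  golomb′ (inj₁ r) = D.golomb r
  golomb′ (inj₂ r) = E.golomb r
  bounded′ : ∀ r i → 1 ℕ.≤ T r i × T r i ℕ.≤ n
  bounded′ (inj₁ r) = D.bounded r
  bounded′ (inj₂ r) = E.bounded r
  disjoint′ : ∀ r s → r ≢ s → ∀ i j → T r i ≢ T s j
  disjoint′ (inj₁ r) (inj₁ s) ne     = D.disjoint (ne ∘ cong inj₁)
  disjoint′ (inj₂ r) (inj₂ s) ne     = E.disjoint (ne ∘ cong inj₂)
  disjoint′ (inj₁ r) (inj₂ s) _ i j   = apart r i s j
  disjoint′ (inj₂ r) (inj₁ s) _ i j e = apart s j r i (sym e)

-- With `t = 0` this only enlarges the range.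
translateUp : ∀ {I J n R} t N → IsDGR I J n R → t ℕ.+ n ℕ.≤ N → IsDGR I J N (λ r i → t ℕ.+ R r i)
translateUp t N D le = translate t 0 D (λ _ _ → refl) λ r i →
  let 1≤x , x≤n = IsDGR.bounded D r i in
  ℕ.≤-trans 1≤x (ℕ.m≤n+m _ t) , ℕ.≤-trans (ℕ.+-monoʳ-≤ t x≤n) le

concatDGR : ∀ {a b J m n} → DGR a J m → DGR b J n → DGR (a ℕ.+ b) J (m ℕ.+ n)
concatDGR {m = m} {n} (R , D) (S , E) =
  joinDGR (translateUp 0 (m ℕ.+ n) D (ℕ.m≤m+n m n)) (translateUp m (m ℕ.+ n) E ℕ.≤-refl)
    λ r i s j e → ℕ.<-irrefl e (ℕ.≤-<-trans (proj₂ (IsDGR.bounded D r i))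
      (ℕ.m<m+n m (proj₁ (IsDGR.bounded E s j))))

-- Translates of a single ruler of the given DGR, side by side. This compares `H a J` with `H b J`.
copies : ∀ a {b J m} .{{_ : NonZero b}} → DGR b J m → DGR a J (a ℕ.* m)
copies zero    _ = (λ ()) , record { golomb = λ () ; bounded = λ () ; disjoint = λ { {()} } }
copies (suc a) {suc b} d@(R , D) = concatDGR one (copies a d)
  where
  open IsDGR D
  one : DGR 1 _ _
  one = (λ _ → R zero) , record
    { golomb   = λ _ → golomb zero
    ; bounded  = λ _ → bounded zero
    ; disjoint = λ { {zero} {zero} ne → contradiction refl ne }
    }

private

  ≤-via : ∀ {m n} o → m ℕ.+ o ≡ n → m ℕ.≤ n
  ≤-via {m} o e = ℕ.≤-trans (ℕ.m≤m+n m o) (ℕ.≤-reflexive e)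

  +-assoc₄ : ∀ e p c q → e ℕ.+ (p ℕ.+ c ℕ.+ q) ≡ e ℕ.+ p ℕ.+ c ℕ.+ q
  +-assoc₄ = ℕ-Solver.solve-∀

-- Merging DGRs across a gap

module _ {a J p c q : ℕ} {R : Fin a → Fin J → ℕ}
  (D : IsDGR a J (p ℕ.+ c ℕ.+ q) R) (block : ∀ r i → InEither 0 p (p ℕ.+ c) q (R r i)) where

  private

    -- L B U
    insert : ∀ {b m} → p ℕ.≤ m → q ℕ.≤ m → DGR b J m → DGR (a ℕ.+ b) J (p ℕ.+ m ℕ.+ q)
    insert {b} {m} p≤m q≤m (S , E)
      with T , F , inT ← spliceDGR {N = p ℕ.+ m ℕ.+ q} false 0 (p ℕ.+ m) m p≤m q≤m
             ℕ.≤-refl (≤-via (m ℕ.+ q) (sym (ℕ.+-assoc p m q))) ℕ.≤-refl D block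
      = joinDGR F (translateUp p (p ℕ.+ m ℕ.+ q) E (ℕ.m≤m+n (p ℕ.+ m) q)) apart
      where
      inB : ∀ s j → In p m (p ℕ.+ S s j)
      inB s j = let 1≤x , x≤m = IsDGR.bounded E s j in
        ℕ.m<m+n p 1≤x , ℕ.+-monoʳ-≤ p x≤m
      apart : ∀ r i s j → T r i ≢ p ℕ.+ S s j
      apart r i s j with inT r i
      ... | inj₁ h = In-disjoint ℕ.≤-refl h (inB s j)
      ... | inj₂ h = ≢-sym (In-disjoint ℕ.≤-refl (inB s j) h)

    cut : ∀ {b J m n S} → IsDGR b J (m ℕ.+ n) S → ∀ r i → InEither 0 m m n (S r i)
    cut {m = m} E r i with bnd ← IsDGR.bounded E r i with _ ℕ.≤? m
    ... | yes x≤m = inj₁ (proj₁ bnd , x≤m)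
    ... | no  x≰m = inj₂ (ℕ.≰⇒> x≰m , proj₂ bnd)

    -- B₁ L B₂ U, with B₂ in the gap
    fillFromBelow : ∀ {b e} → e ℕ.≤ p → c ℕ.≤ p → DGR b J (e ℕ.+ c) →
                    DGR (a ℕ.+ b) J (e ℕ.+ p ℕ.+ c ℕ.+ q)
    fillFromBelow {b} {e} e≤p c≤p (S , E)
      with T , F , inT ← spliceDGR {N = e ℕ.+ p ℕ.+ c ℕ.+ q} false 0 (e ℕ.+ p) p e≤p c≤p
             ℕ.≤-refl (≤-via (p ℕ.+ c ℕ.+ q) (+-assoc₄ e p c q)) (ℕ.m≤m+n _ q) E (cut E)
      = joinDGR (translateUp e (e ℕ.+ p ℕ.+ c ℕ.+ q) D (ℕ.≤-reflexive (+-assoc₄ e p c q))) F apart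
      where
      apart : ∀ r i s j → e ℕ.+ R r i ≢ T s j
      apart r i s j with block r i | inT s j
      ... | inj₁ h | inj₁ h′ = ≢-sym (In-disjoint (ℕ.m≤m+n e 0) h′ (In-shift e h))
      ... | inj₁ h | inj₂ h′ =
        In-disjoint (ℕ.≤-reflexive (cong (ℕ._+ p) (ℕ.+-identityʳ e))) (In-shift e h) h′
      ... | inj₂ h | inj₁ h′ = ≢-sym (In-disjoint (ℕ.m≤m+n e _) h′ (In-shift e h))
      ... | inj₂ h | inj₂ h′ =
        ≢-sym (In-disjoint (ℕ.≤-reflexive (ℕ.+-assoc e p c)) h′ (In-shift e h))

    -- L B₁ U B₂, with B₁ in the gap
    fillFromAbove : ∀ {b e} → c ℕ.≤ q → e ℕ.≤ q → DGR b J (c ℕ.+ e) →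
                    DGR (a ℕ.+ b) J (p ℕ.+ c ℕ.+ q ℕ.+ e)
    fillFromAbove {b} {e} c≤q e≤q (S , E)
      with T , F , inT ← spliceDGR {N = p ℕ.+ c ℕ.+ q ℕ.+ e} false p (p ℕ.+ c ℕ.+ q) q c≤q e≤q
             ℕ.≤-refl (≤-via (q ℕ.+ e) (sym (ℕ.+-assoc (p ℕ.+ c) q e))) ℕ.≤-refl E (cut E)
      = joinDGR (translateUp 0 (p ℕ.+ c ℕ.+ q ℕ.+ e) D (ℕ.m≤m+n _ e)) F apart
      where
      apart : ∀ r i s j → R r i ≢ T s j
      apart r i s j with inT s j
      ... | inj₂ h′ = In-disjoint ℕ.≤-refl (IsDGR.bounded D r i) h′
      ... | inj₁ h′ with block r i
      ...   | inj₁ h = In-disjoint ℕ.≤-refl h h′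
      ...   | inj₂ h = ≢-sym (In-disjoint ℕ.≤-refl h′ h)

  -- The bound `c ≤ m` allows m = c + e, so that a part of length `c` can fill the gap exactly. If
  -- `p` or `q` exceeds `m`, that block is longer than both parts of B and can separate them.
  mergeAcrossGap : ∀ {b m} → c ℕ.≤ m → DGR b J m → DGR (a ℕ.+ b) J (p ℕ.+ q ℕ.+ m)
  mergeAcrossGap {b} {m} c≤m E with e , refl ← ℕ.m≤n⇒∃[o]m+o≡n c≤m | p ℕ.≤? m | q ℕ.≤? m
  ... | yes p≤m | yes q≤m =
    subst (DGR _ J) (eq p c e q) (insert p≤m q≤m E)
    where
    eq : ∀ p c e q → p ℕ.+ (c ℕ.+ e) ℕ.+ q ≡ p ℕ.+ q ℕ.+ (c ℕ.+ e)
    eq = ℕ-Solver.solve-∀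
  ... | no p≰m | _ =
    subst (DGR _ J) (eq p c e q)
      (fillFromBelow (ℕ.≤-trans (ℕ.m≤n+m e c) m≤p) (ℕ.≤-trans (ℕ.m≤m+n c e) m≤p)
        -- Here the part in the gap is the upper one, so B is cut after `e` positions.
        (subst (DGR b J) (ℕ.+-comm c e) E))
    where
    m≤p = ℕ.<⇒≤ (ℕ.≰⇒> p≰m)
    eq : ∀ p c e q → e ℕ.+ p ℕ.+ c ℕ.+ q ≡ p ℕ.+ q ℕ.+ (c ℕ.+ e)
    eq = ℕ-Solver.solve-∀
  ... | yes _ | no q≰m =
    subst (DGR _ J) (eq p c e q)
      (fillFromAbove (ℕ.≤-trans (ℕ.m≤m+n c e) m≤q) (ℕ.≤-trans (ℕ.m≤n+m e c) m≤q) E)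
    where
    m≤q = ℕ.<⇒≤ (ℕ.≰⇒> q≰m)
    eq : ∀ p c e q → p ℕ.+ c ℕ.+ q ℕ.+ e ≡ p ℕ.+ q ℕ.+ (c ℕ.+ e)
    eq = ℕ-Solver.solve-∀

  private

    -- Each copy occupies two blocks, so keeping two copies apart takes four comparisons of
    -- intervals.
    apart₄ : ∀ {l m l₁ n₁ l₂ n₂ x y} → InEither l p m q x → InEither l₁ n₁ l₂ n₂ y →
             (∀ {x y} → In l p x → In l₁ n₁ y → x ≢ y) → (∀ {x y} → In l p x → In l₂ n₂ y → x ≢ y) →
             (∀ {x y} → In m q x → In l₁ n₁ y → x ≢ y) → (∀ {x y} → In m q x → In l₂ n₂ y → x ≢ y) →
             x ≢ y
    apart₄ (inj₁ h) (inj₁ h′) f _ _ _ = f h h′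
    apart₄ (inj₁ h) (inj₂ h′) _ f _ _ = f h h′
    apart₄ (inj₂ h) (inj₁ h′) _ _ f _ = f h h′
    apart₄ (inj₂ h) (inj₂ h′) _ _ _ f = f h h′

    -- U₁ L₂ L₁ U₂
    interleave-p≥q : q ℕ.≤ p → DGR (a ℕ.+ a) J (q ℕ.+ p ℕ.+ p ℕ.+ q)
    interleave-p≥q q≤p
      with T , F , inT ← spliceDGR {N = q ℕ.+ p ℕ.+ p ℕ.+ q} true (q ℕ.+ p) 0 p ℕ.≤-refl q≤p
             ℕ.≤-refl (ℕ.m≤m+n _ q) (≤-via (p ℕ.+ p ℕ.+ q) (+-assoc₄ q p p q)) D block
         | T′ , F′ , inT′ ← spliceDGR {N = q ℕ.+ p ℕ.+ p ℕ.+ q} false q (q ℕ.+ p ℕ.+ p) p ℕ.≤-refl q≤p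
             ℕ.≤-refl (≤-via (p ℕ.+ q) (sym (ℕ.+-assoc (q ℕ.+ p) p q))) ℕ.≤-refl D block
      = joinDGR F F′ λ r i s j → apart₄ (inT r i) (inT′ s j)
          (λ h h′ → ≢-sym (In-disjoint ℕ.≤-refl h′ h))
          (In-disjoint ℕ.≤-refl)
          (In-disjoint ℕ.≤-refl)
          (In-disjoint (≤-via (p ℕ.+ p) (sym (ℕ.+-assoc q p p))))

    -- L₁ U₂ U₁ L₂
    interleave-p≤q : p ℕ.≤ q → DGR (a ℕ.+ a) J (p ℕ.+ q ℕ.+ q ℕ.+ p)
    interleave-p≤q p≤q
      with T , F , inT ← spliceDGR {N = p ℕ.+ q ℕ.+ q ℕ.+ p} false 0 (p ℕ.+ q) q p≤q ℕ.≤-refl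
             ℕ.≤-refl (≤-via (q ℕ.+ q ℕ.+ p) (+-assoc₄ p q q p)) (ℕ.m≤m+n _ p) D block
         | T′ , F′ , inT′ ← spliceDGR {N = p ℕ.+ q ℕ.+ q ℕ.+ p} true (p ℕ.+ q ℕ.+ q) p q p≤q ℕ.≤-refl
             ℕ.≤-refl ℕ.≤-refl (≤-via (q ℕ.+ p) (sym (ℕ.+-assoc (p ℕ.+ q) q p))) D block
      = joinDGR F F′ λ r i s j → apart₄ (inT r i) (inT′ s j)
          (In-disjoint (≤-via (q ℕ.+ q) (sym (ℕ.+-assoc p q q))))
          (In-disjoint ℕ.≤-refl)
          (In-disjoint ℕ.≤-refl)
          (λ h h′ → ≢-sym (In-disjoint ℕ.≤-refl h′ h))

  -- In either arrangement, the two blocks of one copy are separated by the longer block of the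
  -- other copy, whose length bounds both.
  doubleAcrossGap : DGR (a ℕ.+ a) J (2 ℕ.* (p ℕ.+ q))
  doubleAcrossGap with ℕ.≤-total q p
  ... | inj₁ q≤p = subst (DGR _ J) (eq q p) (interleave-p≥q q≤p)
    where
    eq : ∀ q p → q ℕ.+ p ℕ.+ p ℕ.+ q ≡ 2 ℕ.* (p ℕ.+ q)
    eq = ℕ-Solver.solve-∀
  ... | inj₂ p≤q = subst (DGR _ J) (eq p q) (interleave-p≤q p≤q)
    where
    eq : ∀ p q → p ℕ.+ q ℕ.+ q ℕ.+ p ≡ 2 ℕ.* (p ℕ.+ q)
    eq = ℕ-Solver.solve-∀

-- Gaps of optimal DGRs

module _ {a J n : ℕ} {R : Fin a → Fin J → ℕ} (D : IsDGR a J n R) where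

  private
    open IsDGR D

    used? : ∀ x → Dec (∃[ r ] ∃[ i ] R r i ≡ x)
    used? x = Fin.any? λ r → Fin.any? λ i → R r i ℕ.≟ x

  module _ (1<n : 1 ℕ.< n) (minimal : ∀ m → 1 ℕ.≤ m → DGR a J m → n ℕ.≤ m) where

    private

      -- Minimality ranges over positive lengths; `1<n` makes `pred n` one of them.
      no-shorter : ¬ DGR a J (ℕ.pred n)
      no-shorter E = ℕ.<-irrefl refl (ℕ.<-≤-trans (pred< 1<n) (minimal _ (ℕ.<⇒≤pred 1<n) E))
        where
        pred< : ∀ {n} → 1 ℕ.< n → ℕ.pred n ℕ.< n
        pred< {suc n} _ = ℕ.n<1+n n

    -- Otherwise all marks could move down by one and fit into n - 1 positions.
    first-used : ∃[ r ] ∃[ i ] R r i ≡ 1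
    first-used = decidable-stable (used? 1) λ unused → no-shorter
      ((λ r i → ℕ.pred (R r i)) , translate 0 1 D
        (λ r i → sym (ℕ.suc-pred (R r i) {{ℕ.>-nonZero (proj₁ (bounded r i))}}))
        λ r i → ℕ.<⇒≤pred (ℕ.≤∧≢⇒< (proj₁ (bounded r i)) (λ e → unused (r , i , sym e)))
              , ℕ.pred-mono-≤ (proj₂ (bounded r i)))

    last-used : ∃[ r ] ∃[ i ] R r i ≡ n
    last-used = decidable-stable (used? n) λ unused → no-shorter
      (R , translate 0 0 D (λ _ _ → refl)
        λ r i → proj₁ (bounded r i)
              , ℕ.<⇒≤pred (ℕ.≤∧≢⇒< (proj₂ (bounded r i)) (λ e → unused (r , i , e))))

    private

      module Windows (c : ℕ) where

        -- The windows (0,1], (1,1+c], (1+c,1+2c], …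

        edge : ℕ → ℕ
        edge zero    = 0
        edge (suc k) = suc (k ℕ.* c)

        edge-mono : ∀ {k l} → k ℕ.< l → edge (suc k) ℕ.≤ edge l
        edge-mono (s≤s k≤l) = s≤s (ℕ.*-monoˡ-≤ c k≤l)

        Hit : ℕ → Set
        Hit k = ∃[ r ] ∃[ i ] (edge k ℕ.< R r i × R r i ℕ.≤ edge (suc k))

        hit? : ∀ k → Dec (Hit k)
        hit? k = Fin.any? λ r → Fin.any? λ i → (edge k ℕ.<? R r i) ×-dec (R r i ℕ.≤? edge (suc k))

        first-hit : Hit 0
        first-hit with r , i , e ← first-used =
          r , i , subst (0 ℕ.<_) (sym e) ℕ.z<s , ℕ.≤-reflexive e

        -- n is a mark outside all the windows considered.
        not-all-hit : edge (a ℕ.* J) ℕ.< n → ¬ (∀ (k : Fin (a ℕ.* J)) → Hit (toℕ k))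
        not-all-hit short hit with r₀ , i₀ , e₀ ← last-used = no-collision (Fin.pigeonhole (ℕ.n<1+n _) f)
          where
          mark : Fin (suc (a ℕ.* J)) → Fin a × Fin J
          -- Index 0 stands for the mark `n`, index `suc k` for a mark in window `k`: one index more
          -- than there are marks.
          mark zero    = r₀ , i₀
          mark (suc k) = proj₁ (hit k) , proj₁ (proj₂ (hit k))

          value : Fin (suc (a ℕ.* J)) → ℕ
          value k = R (proj₁ (mark k)) (proj₂ (mark k))

          f : Fin (suc (a ℕ.* J)) → Fin (a ℕ.* J)
          f k = combine (proj₁ (mark k)) (proj₂ (mark k))

          f⇒value : ∀ k l → f k ≡ f l → value k ≡ value l
          f⇒value k l e = let e₁ , e₂ = Fin.combine-injective _ _ _ _ e in cong₂ R e₁ e₂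

          no-collision : ¬ (∃₂ λ k l → k Fin.< l × f k ≡ f l)
          -- The mark `n` lies beyond the last edge, and a window ends no later than any following
          -- one begins, so the chosen marks have different values.
          no-collision (zero , suc l , _ , e) = ℕ.<-irrefl (trans (sym (f⇒value zero (suc l) e)) e₀)
            (ℕ.≤-<-trans (ℕ.≤-trans (proj₂ (proj₂ (proj₂ (hit l)))) (edge-mono {l = a ℕ.* J} (Fin.toℕ<n l))) short)
          no-collision (suc k , suc l , s≤s k<l , e) = ℕ.<-irrefl (f⇒value (suc k) (suc l) e)
            (ℕ.≤-<-trans (ℕ.≤-trans (proj₂ (proj₂ (proj₂ (hit k)))) (edge-mono k<l))
                         (proj₁ (proj₂ (proj₂ (hit l)))))

    -- The first window and aJ - 1 windows of length `c` end at 1 + c(aJ - 1), before `n`. One of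
    -- them is missed, and not the first, which contains the mark 1; so the missed window has length
    -- `c` and `1 ≤ p`.
    gap : ∀ c → .{{_ : NonZero (a ℕ.* J)}} → suc (c ℕ.* (a ℕ.* J ℕ.∸ 1)) ℕ.< n →
          ∃₂ λ p q → 1 ℕ.≤ p × p ℕ.+ c ℕ.+ q ≡ n × (∀ r i → InEither 0 p (p ℕ.+ c) q (R r i))
    gap c short with Fin.any? {n = a ℕ.* J} (λ k → ¬? (Windows.hit? c (toℕ k)))
    ... | no none = contradiction
        (λ k → decidable-stable (hit? (toℕ k)) λ miss → none (k , miss))
        (not-all-hit (subst (ℕ._< n) edge≡ short))
      where
      open Windows c
      edge≡ : suc (c ℕ.* (a ℕ.* J ℕ.∸ 1)) ≡ edge (a ℕ.* J)
      edge≡ = trans (cong suc (ℕ.*-comm c _)) (cong edge (ℕ.suc-pred (a ℕ.* J)))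
    ... | yes (k , miss) = go (toℕ k) (Fin.toℕ<n k) miss
      where
      open Windows c
      go : ∀ k → k ℕ.< a ℕ.* J → ¬ Hit k →
           ∃₂ λ p q → 1 ℕ.≤ p × p ℕ.+ c ℕ.+ q ≡ n × (∀ r i → InEither 0 p (p ℕ.+ c) q (R r i))
      go zero    _   miss = contradiction first-hit miss
      -- The missed window is (p, p + c] with p = 1 + kc, and U takes all positions from `top` to
      -- `n`.
      go (suc k) k<N miss = suc (k ℕ.* c) , n ℕ.∸ top , s≤s z≤n , ℕ.m+[n∸m]≡n top≤n , block
        where
        top = suc (k ℕ.* c) ℕ.+ c

        top≡ : edge (suc (suc k)) ≡ top
        top≡ = cong suc (ℕ.+-comm c (k ℕ.* c))

        top≤n : top ℕ.≤ n
        top≤n = begin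
          top                            ≡⟨ top≡ ⟨
          suc (suc k ℕ.* c)              ≤⟨ s≤s (ℕ.*-monoˡ-≤ c (ℕ.<⇒≤pred k<N)) ⟩
          suc ((a ℕ.* J ℕ.∸ 1) ℕ.* c)    ≡⟨ cong suc (ℕ.*-comm _ c) ⟩
          suc (c ℕ.* (a ℕ.* J ℕ.∸ 1))    ≤⟨ ℕ.<⇒≤ short ⟩
          n                              ∎
          where open ℕ.≤-Reasoning

        block : ∀ r i → InEither 0 (suc (k ℕ.* c)) top (n ℕ.∸ top) (R r i)
        block r i with R r i ℕ.≤? suc (k ℕ.* c)
        ... | yes low = inj₁ (proj₁ (bounded r i) , low)
        ... | no  ¬low = inj₂
          ( ℕ.≰⇒> (λ le → miss (r , i , ℕ.≰⇒> ¬low , subst (R r i ℕ.≤_) (sym top≡) le))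
          , ℕ.≤-trans (proj₂ (bounded r i)) (ℕ.≤-reflexive (sym (ℕ.m+[n∸m]≡n top≤n))))

-- Ceilings and the two bounds

ceiling-ℕ : ∀ h d .{{_ : NonZero h}} .{{_ : NonZero d}} →
            ∃[ c ] (ceiling (+ h / d) ≡ + c × c ℕ.* d ℕ.< h ℕ.+ d)
ceiling-ℕ (suc h) d@(suc _) with suc h ℕ.% d in eq
-- `ceiling` is minus the floor of the negated fraction, and integer division of a negative number
-- branches on the remainder. If it is zero, the bound holds since cd ≤ h and d > 0; otherwise the
-- quotient is raised by one and the positive remainder gives strictness.
... | zero = suc h ℕ./ d , trans (cong ℤ.-_ (ℤ.*-identityˡ _)) (ℤ.neg-involutive _) ,
  ℕ.≤-<-trans (m/n*n≤m (suc h) d) (ℕ.m<m+n (suc h) ℕ.z<s)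
... | suc r = suc (suc h ℕ./ d) , cong ℤ.-_ (ℤ.*-identityˡ ℤ.-[1+ suc h ℕ./ d ]) , (begin-strict
    d ℕ.+ (suc h ℕ./ d) ℕ.* d                   <⟨ ℕ.+-monoʳ-< d (ℕ.m<n+m _ {suc r} ℕ.z<s) ⟩
    d ℕ.+ (suc r ℕ.+ (suc h ℕ./ d) ℕ.* d)       ≡⟨ cong (λ x → d ℕ.+ (x ℕ.+ (suc h ℕ./ d) ℕ.* d)) eq ⟨
    d ℕ.+ (suc h ℕ.% d ℕ.+ (suc h ℕ./ d) ℕ.* d) ≡⟨ cong (d ℕ.+_) (m≡m%n+[m/n]*n (suc h) d) ⟨
    d ℕ.+ suc h                                 ≡⟨ ℕ.+-comm d (suc h) ⟩
    suc h ℕ.+ d                                 ∎)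
  where open ℕ.≤-Reasoning

private

  ≤-minus : ∀ {x y} c → x ℕ.+ c ℕ.≤ y → + x ≤ + y - + c
  ≤-minus {x} {y} c le = begin
    + x                ≡⟨ cancel (+ x) (+ c) ⟩
    + (x ℕ.+ c) - + c  ≤⟨ ℤ.+-monoˡ-≤ (ℤ.- (+ c)) (ℤ.+≤+ le) ⟩
    + y - + c          ∎
    where
    open ℤ.≤-Reasoning
    cancel : ∀ x c → x ≡ (x + c) - c
    cancel = ℤ-Solver.solve-∀

H-minimal : ∀ I J m → 1 ℕ.≤ m → DGR I J m → H I J ℕ.≤ m
H-minimal I J m 1≤m E = proj₂ (H-isLeast I J) m (1≤m , E)

H-DGR : ∀ I J → DGR I J (H I J)
H-DGR I J = proj₂ (proj₁ (H-isLeast I J))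

H-positive : ∀ I J → 1 ℕ.≤ H I J
H-positive I J = proj₁ (proj₁ (H-isLeast I J))

H≤copies : ∀ a b J .{{_ : NonZero a}} .{{_ : NonZero b}} → H a J ℕ.≤ a ℕ.* H b J
H≤copies a b J = H-minimal a J _
  (ℕ.*-mono-≤ (ℕ.>-nonZero⁻¹ a) (H-positive b J)) (copies a (H-DGR b J))

module _ (a b J : ℕ) .{{_ : NonZero a}} .{{_ : NonZero b}} (3≤J : 3 ℕ.≤ J) where

  private
    instance
      J≢0 : NonZero J
      J≢0 = ℕ.>-nonZero (ℕ.≤-trans (s≤s z≤n) 3≤J)
      aJ≢0 : NonZero (a ℕ.* J)
      aJ≢0 = ℕ.m*n≢0 a J

    a<aJ : a ℕ.< a ℕ.* J
    a<aJ = ℕ.m<m*n a J (ℕ.≤-trans (s≤s (s≤s z≤n)) 3≤J)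

  -- Dropping the gap saves `c` positions once when another DGR is merged in, and twice when two
  -- copies interlock. Both bounds are stated additively to stay within the natural numbers.
  H-gap-bounds : ∀ c → suc (c ℕ.* (a ℕ.* J ℕ.∸ 1)) ℕ.< H a J →
                 H (a ℕ.+ b) J ℕ.+ c ℕ.≤ H a J ℕ.+ H b J ×
                 H (2 ℕ.* a) J ℕ.+ 2 ℕ.* c ℕ.≤ 2 ℕ.* H a J
  H-gap-bounds c short = bounds (H-DGR a J)
    where
    c≤Hb : c ℕ.≤ H b J
    -- B must have enough positions to fill the gap. The last estimate uses a ≤ aJ - 1, and the
    -- common factor aJ - 1 is then cancelled.
    c≤Hb = ℕ.<⇒≤ (ℕ.*-cancelʳ-< (a ℕ.* J ℕ.∸ 1) c (H b J) (begin-strict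
      c ℕ.* (a ℕ.* J ℕ.∸ 1)     <⟨ ℕ.<-trans (ℕ.n<1+n _) short ⟩
      H a J                     ≤⟨ H≤copies a b J ⟩
      a ℕ.* H b J               ≤⟨ ℕ.*-monoˡ-≤ (H b J) (ℕ.<⇒≤pred a<aJ) ⟩
      (a ℕ.* J ℕ.∸ 1) ℕ.* H b J ≡⟨ ℕ.*-comm _ (H b J) ⟩
      H b J ℕ.* (a ℕ.* J ℕ.∸ 1) ∎))
      where open ℕ.≤-Reasoning

    bounds : DGR a J (H a J) → _
    bounds (R , D)
      with p , q , 1≤p , n≡ , block ← gap D (ℕ.≤-trans (s≤s (s≤s z≤n)) short) (H-minimal a J) c short =
      sum-bound , double-bound
      where
      D′ = subst (λ n → IsDGR a J n R) (sym n≡) D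

      sum-bound : H (a ℕ.+ b) J ℕ.+ c ℕ.≤ H a J ℕ.+ H b J
      sum-bound = begin
        H (a ℕ.+ b) J ℕ.+ c         ≤⟨ ℕ.+-monoˡ-≤ c (H-minimal _ J _
                                         (ℕ.≤-trans (H-positive b J) (ℕ.m≤n+m (H b J) (p ℕ.+ q)))
                                         (mergeAcrossGap D′ block c≤Hb (H-DGR b J))) ⟩
        p ℕ.+ q ℕ.+ H b J ℕ.+ c     ≡⟨ eq p q (H b J) c ⟩
        p ℕ.+ c ℕ.+ q ℕ.+ H b J     ≡⟨ cong (ℕ._+ H b J) n≡ ⟩
        H a J ℕ.+ H b J             ∎
        where
        open ℕ.≤-Reasoning
        eq : ∀ p q m c → p ℕ.+ q ℕ.+ m ℕ.+ c ≡ p ℕ.+ c ℕ.+ q ℕ.+ m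
        eq = ℕ-Solver.solve-∀

      double-bound : H (2 ℕ.* a) J ℕ.+ 2 ℕ.* c ℕ.≤ 2 ℕ.* H a J
      double-bound = begin
        H (2 ℕ.* a) J ℕ.+ 2 ℕ.* c         ≤⟨ ℕ.+-monoˡ-≤ (2 ℕ.* c) (H-minimal _ J _
                                               (ℕ.≤-trans 1≤p (ℕ.≤-trans (ℕ.m≤m+n p q) (ℕ.m≤m+n (p ℕ.+ q) _)))
                                               (subst (λ I → DGR I J (2 ℕ.* (p ℕ.+ q))) (cong (a ℕ.+_) (sym (ℕ.+-identityʳ a)))
                                                 (doubleAcrossGap D′ block))) ⟩
        2 ℕ.* (p ℕ.+ q) ℕ.+ 2 ℕ.* c       ≡⟨ eq p q c ⟩
        2 ℕ.* (p ℕ.+ c ℕ.+ q)             ≡⟨ cong (2 ℕ.*_) n≡ ⟩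
        2 ℕ.* H a J                       ∎
        where
        open ℕ.≤-Reasoning
        eq : ∀ p q c → 2 ℕ.* (p ℕ.+ q) ℕ.+ 2 ℕ.* c ≡ 2 ℕ.* (p ℕ.+ c ℕ.+ q)
        eq = ℕ-Solver.solve-∀

theorem6 :
    ∀ (a b J : ℕ) .{{_ : NonZero a}} .{{_ : NonZero b}} (3≤J : 3 ℕ.≤ J) →
    H a J ℕ.≥ a ℕ.* J ℕ.+ 1 →
    let instance
          nz : NonZero (a ℕ.* J ℕ.∸ 1)
          nz = a*J∸1≢0 a J 3≤J
        c = ceiling ((+ H a J - + (a ℕ.* J)) / (a ℕ.* J ℕ.∸ 1))
    in (+ H (a ℕ.+ b) J ≤ + H a J + + H b J - c)
       × (+ H (2 ℕ.* a) J ≤ + 2 * + H a J - + 2 * c)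
theorem6 a b J 3≤J big = conclude (ceiling-ℕ (H a J ℕ.∸ a ℕ.* J) (a ℕ.* J ℕ.∸ 1))
  where
  instance
    nz : NonZero (a ℕ.* J ℕ.∸ 1)
    nz = a*J∸1≢0 a J 3≤J
    excess≢0 : NonZero (H a J ℕ.∸ a ℕ.* J)
    excess≢0 = ℕ.>-nonZero (ℕ.m<n⇒0<n∸m (subst (ℕ._≤ H a J) (ℕ.+-comm (a ℕ.* J) 1) big))

  aJ≤H : a ℕ.* J ℕ.≤ H a J
  aJ≤H = ℕ.≤-trans (ℕ.m≤m+n _ 1) big

  Goal : ℤ.ℤ → Set
  Goal c = (+ H (a ℕ.+ b) J ≤ + H a J + + H b J - c) × (+ H (2 ℕ.* a) J ≤ + 2 * + H a J - + 2 * c)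

  conclude : ∃[ c ] (ceiling (+ (H a J ℕ.∸ a ℕ.* J) / (a ℕ.* J ℕ.∸ 1)) ≡ + c ×
                     c ℕ.* (a ℕ.* J ℕ.∸ 1) ℕ.< H a J ℕ.∸ a ℕ.* J ℕ.+ (a ℕ.* J ℕ.∸ 1)) →
             Goal (ceiling ((+ H a J - + (a ℕ.* J)) / (a ℕ.* J ℕ.∸ 1)))
  conclude (c , c≡ , c<) = subst Goal (sym ceiling≡)
    ( ≤-minus c (proj₁ bounds)
    , subst₂ (λ x y → + H (2 ℕ.* a) J ≤ x - y) (ℤ.pos-* 2 (H a J)) (ℤ.pos-* 2 c)
        (≤-minus (2 ℕ.* c) (proj₂ bounds)))
    where
    ceiling≡ : ceiling ((+ H a J - + (a ℕ.* J)) / (a ℕ.* J ℕ.∸ 1)) ≡ + c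
    ceiling≡ = trans (cong (λ x → ceiling (x / (a ℕ.* J ℕ.∸ 1)))
                       (trans (ℤ.m-n≡m⊖n (H a J) (a ℕ.* J)) (ℤ.⊖-≥ aJ≤H))) c≡

    -- The ceiling bound reads c(aJ - 1) < (H(a,J) - aJ) + (aJ - 1) = H(a,J) - 1, exactly the room
    -- that `gap` asks for.
    short : suc (c ℕ.* (a ℕ.* J ℕ.∸ 1)) ℕ.< H a J
    short = begin-strict
      suc (c ℕ.* (a ℕ.* J ℕ.∸ 1))                  <⟨ s≤s c< ⟩
      suc (H a J ℕ.∸ a ℕ.* J ℕ.+ (a ℕ.* J ℕ.∸ 1))  ≡⟨ ℕ.+-suc _ _ ⟨
      H a J ℕ.∸ a ℕ.* J ℕ.+ suc (a ℕ.* J ℕ.∸ 1)    ≡⟨ cong (H a J ℕ.∸ a ℕ.* J ℕ.+_) (suc-∸1 nz) ⟩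
      H a J ℕ.∸ a ℕ.* J ℕ.+ a ℕ.* J                ≡⟨ ℕ.m∸n+n≡m aJ≤H ⟩
      H a J                                        ∎
      where
      open ℕ.≤-Reasoning
      suc-∸1 : ∀ {n} → NonZero (n ℕ.∸ 1) → suc (n ℕ.∸ 1) ≡ n
      suc-∸1 {suc n} _ = refl

    bounds = H-gap-bounds a b J 3≤J c short
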